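{- Let $k\ge2$, $p\in(0,1)$, $q=1-p$, and $R^{(k)}_n(p)=\mathbb{E}[Y(k,n,p)]$. Then $R^{(k)}_1(p)=1$, for $n\ge2$ $$R^{(k)}_n(p)=n-\frac1q\sum_{i=1}^{n-1}(n-i)\,s^{(k)}_i\,(p^{k-1}q)^i,$$ and $$\sum_{n\ge1}R^{(k)}_n(p)z^n=\frac{z}{(1-z)^2}\left(1-\frac1qS^{(k)}(p^{k-1}qz)\right).$$
   Context: Matchbox process: fix integers $k\ge 2$, $n\ge 1$ and $p\in(0,1)$, $q=1-p$. Initially $k$ boxes each contain $n$ matches. At each time step, independently, with probability $p$ a match is removed from a box currently containing the largest number of matches, and with probability $q$ from a box currently containing the smallest number (ties broken arbitrarily). A diagonal state is a state in which all $k$ boxes contain the same number of matches. Let $Y=Y(k,n,p)$ be the smallest $i\in\{1,\dots,n-1\}$ such that the process reaches the diagonal state in which every box contains $n-i$ matches (before any box is empty), with the convention $Y=n$ if no such $i$ exists. $s^{(k)}_i=\frac{k-1}{ki-1}\binom{ki-1}{i-1}$ and $S^{(k)}(z)=\sum_{i\ge1}s^{(k)}_iz^i$. -}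

module Defs where

open import Level using (_⊔_) renaming (suc to lsuc)
open import Algebra.Apartness.Bundles using (HeytingField; HeytingCommutativeRing)
open import Algebra.Bundles using (CommutativeRing; Semiring)
open import Data.Fin.Base using (Fin; zero; suc; toℕ)
open import Data.List.Base using (List; []; _∷_; map; find; upTo)
open import Data.List.Membership.Propositional using (_∈_)
import Data.List.Membership.DecPropositional as DecMembership
open import Data.Maybe.Base using (fromMaybe)
open import Data.Nat.Base as ℕ
  using (ℕ; zero; suc; pred; NonZero; NonTrivial; _∸_; _≤_)
import Data.Nat.Properties as ℕₚ
open import Data.Nat.Combinatorics using (_C_)
open import Data.Product.Base using (∃-syntax; _×_; proj₁)
open import Data.Sum.Base using (_⊎_; inj₁; inj₂)
open import Data.Vec.Base using (Vec; []; _∷_; lookup; replicate; _[_]%=_; toList)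
import Data.Vec.Properties as Vecₚ
open import Data.Vec.Relation.Unary.Any using (Any; any?)
open import Relation.Binary.Core using (Rel)
open import Relation.Binary.PropositionalEquality.Core using (_≡_)
open import Relation.Binary.Structures using (IsStrictPartialOrder)
open import Relation.Nullary.Decidable using (Dec; yes; no)

module FieldNotation {c ℓ₁ ℓ₂} (F : HeytingField c ℓ₁ ℓ₂) where
  open HeytingField F
  open HeytingCommutativeRing heytingCommutativeRing public using (commutativeRing)
  open CommutativeRing commutativeRing public using (semiring; ring)
  open import Algebra.Definitions.RawSemiring
    (Semiring.rawSemiring semiring) public using (_^_)
    renaming (_×_ to _×ᶠ_)

  ι : ℕ → Carrier
  ι n = n ×ᶠ 1#

-- The real numbers, given axiomatically as a Cauchy-complete
-- Archimedean ordered field.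
record RealNumbers c ℓ₁ ℓ₂ : Set (lsuc (c ⊔ ℓ₁ ⊔ ℓ₂)) where
  field
    heytingField : HeytingField c ℓ₁ ℓ₂

  open HeytingField heytingField public
  open FieldNotation heytingField public

  infix 4 _<_
  field
    _<_                  : Rel Carrier ℓ₂
    isStrictPartialOrder : IsStrictPartialOrder _≈_ _<_
    <⇒#                  : ∀ {x y} → x < y → x # y
    #⇒<⊎>                : ∀ {x y} → x # y → x < y ⊎ y < x
    +-monoˡ-<            : ∀ {x y} z → x < y → x + z < y + z
    *-pos                : ∀ {x y} → 0# < x → 0# < y → 0# < x * y
    archimedean          : ∀ x → ∃[ n ] x < ι n
    -- Both inequalities |u m - u n| < ε and |u n - l| < ε are spelled
    -- out without an absolute value; in the first one the roles of m
    -- and n may be exchanged.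
    complete             : ∀ (u : ℕ → Carrier) →
      (∀ ε → 0# < ε → ∃[ N ] (∀ m n → N ≤ m → N ≤ n → u m - u n < ε)) →
      ∃[ l ] (∀ ε → 0# < ε → ∃[ N ] (∀ n → N ≤ n → u n - l < ε × l - u n < ε))

  open IsStrictPartialOrder isStrictPartialOrder public
    using (<-resp-≈; <-respˡ-≈; <-respʳ-≈)
    renaming (irrefl to <-irrefl; trans to <-trans)

module RealProperties {c ℓ₁ ℓ₂} (ℝ : RealNumbers c ℓ₁ ℓ₂) where
  open RealNumbers ℝ
  open import Algebra.Properties.Ring ring using (-1*x≈-x; -‿involutive; -0#≈0#)

  x<y⇒0<y-x : ∀ {x y} → x < y → 0# < y - x
  x<y⇒0<y-x {x} x<y = <-respˡ-≈ (-‿inverseʳ x) (+-monoˡ-< (- x) x<y)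

  0<1 : 0# < 1#
  0<1 with #⇒<⊎> (invertible⇒# (1# , 1*[1-0]≈1 , trans (*-comm _ _) 1*[1-0]≈1))
    where
    open import Data.Product.Base using (_,_)
    1*[1-0]≈1 : 1# * (1# - 0#) ≈ 1#
    1*[1-0]≈1 = trans (*-identityˡ _) (trans (+-congˡ -0#≈0#) (+-identityʳ 1#))
  ... | inj₂ 0<1 = 0<1
  ... | inj₁ 1<0 = <-respʳ-≈ -1*-1≈1 (*-pos 0<-1 0<-1)
    where
    0<-1 : 0# < - 1#
    0<-1 = <-respʳ-≈ (+-identityˡ _) (x<y⇒0<y-x 1<0)
    -1*-1≈1 : - 1# * - 1# ≈ 1#
    -1*-1≈1 = trans (-1*x≈-x _) (-‿involutive 1#)

  0<ι[1+n] : ∀ n → 0# < ι (suc n)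
  0<ι[1+n] zero    = <-respʳ-≈ (sym (+-identityʳ 1#)) 0<1
  0<ι[1+n] (suc n) = <-trans (0<ι[1+n] n)
    (<-respˡ-≈ (+-identityˡ _) (+-monoˡ-< (ι (suc n)) 0<1))

  infix 8 _⁻¹[_]

  _⁻¹[_] : ∀ x → 0# < x → Carrier
  x ⁻¹[ 0<x ] = proj₁ (#⇒invertible (#-sym (<⇒# 0<x)))

  *-⁻¹ : ∀ {x} (0<x : 0# < x) → x * x ⁻¹[ 0<x ] ≈ 1#
  *-⁻¹ {x} 0<x = trans (*-congʳ (sym x-0≈x))
    (proj₂ (proj₂ (#⇒invertible (#-sym (<⇒# 0<x)))))
    where
    open import Data.Product.Base using (proj₂)
    x-0≈x : x - 0# ≈ x
    x-0≈x = trans (+-congˡ -0#≈0#) (+-identityʳ x)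

  infixl 7 _/ᴺ_

  _/ᴺ_ : Carrier → (m : ℕ) → .{{NonZero m}} → Carrier
  x /ᴺ suc m = x * ι (suc m) ⁻¹[ 0<ι[1+n] m ]

------------------------------------------------------------------------
-- The matchbox process

State : ℕ → Set
State k = Vec ℕ k

data Coin : Set where
  p-side q-side : Coin

-- Ties may be broken in any way, possibly depending on the whole past:
-- a rule sees the earlier coin tosses (latest first; with the rule itself
-- they determine all earlier states) and the current state.
record TieBreaking (k : ℕ) : Set where
  field
    largest      : List Coin → State k → Fin k
    largest-max  : ∀ past s j → lookup s j ≤ lookup s (largest past s)
    smallest     : List Coin → State k → Fin k
    smallest-min : ∀ past s j → lookup s (smallest past s) ≤ lookup s j

module _ {k : ℕ} (τ : TieBreaking k) where
  open TieBreaking τ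

  chosen : List Coin → State k → Coin → Fin k
  chosen past s p-side = largest past s
  chosen past s q-side = smallest past s

  -- The process stops as soon as some box is empty.
  step : List Coin → State k → Coin → State k
  step past s c with any? (ℕₚ._≟ 0) s
  ... | yes _ = s
  ... | no  _ = s [ chosen past s c ]%= pred

  trajectory : List Coin → State k → List Coin → List (State k)
  trajectory past s []       = s ∷ []
  trajectory past s (c ∷ cs) = s ∷ trajectory (c ∷ past) (step past s c) cs

  -- Every step before stopping removes a match, so k * n tosses exhaust
  -- the process started with n matches in each of the k boxes.
  module _ (n : ℕ) (ω : Vec Coin (k ℕ.* n)) where

    HitsDiagonal : ℕ → Set
    HitsDiagonal m = replicate k m ∈ trajectory [] (replicate k n) (toList ω)

    hitsDiagonal? : ∀ m → Dec (HitsDiagonal m)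
    hitsDiagonal? m = replicate k m ∈? trajectory [] (replicate k n) (toList ω)
      where open DecMembership (Vecₚ.≡-dec ℕₚ._≟_) using (_∈?_)

    Y : ℕ
    Y = fromMaybe n (find (λ i → hitsDiagonal? (n ∸ i)) (map suc (upTo (n ∸ 1))))

module Matchbox {c ℓ₁ ℓ₂} (ℝ : RealNumbers c ℓ₁ ℓ₂) where
  open RealNumbers ℝ
  open RealProperties ℝ public
  open import Algebra.Properties.Semiring.Sum semiring public
    using (sum; sum-syntax)

  -- Expectation with respect to N independent tosses with
  -- P(p-side) = p and P(q-side) = 1 - p.
  𝔼 : Carrier → ∀ {N} → (Vec Coin N → Carrier) → Carrier
  𝔼 p {zero}  f = f []
  𝔼 p {suc N} f = p        * 𝔼 p (λ ω → f (p-side ∷ ω))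
                + (1# - p) * 𝔼 p (λ ω → f (q-side ∷ ω))

  𝔼Y : ∀ {k} → TieBreaking k → ℕ → Carrier → Carrier
  𝔼Y τ n p = 𝔼 p (λ ω → ι (Y τ n ω))

  s : ∀ k i → .{{NonTrivial k}} → .{{NonZero i}} → Carrier
  s k i = (ι (k ∸ 1) /ᴺ (k ℕ.* i ∸ 1)) {{ki∸1≢0 k i}} * ι ((k ℕ.* i ∸ 1) C (i ∸ 1))
    where
    ki∸1≢0 : ∀ k i → .{{NonTrivial k}} → .{{NonZero i}} → NonZero (k ℕ.* i ∸ 1)
    ki∸1≢0 (suc (suc k)) (suc zero)    = _
    ki∸1≢0 (suc (suc k)) (suc (suc i)) = _

  ----------------------------------------------------------------------
  -- Formal power series, as their coefficient sequences

  FPS : Set c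
  FPS = ℕ → Carrier

  infix  4 _≋_
  infixl 6 _⊖_
  infixl 7 _⊛_ _·_

  _≋_ : FPS → FPS → Set ℓ₁
  f ≋ g = ∀ n → f n ≈ g n

  _⊖_ _⊛_ : FPS → FPS → FPS
  (f ⊖ g) n = f n - g n
  (f ⊛ g) n = ∑[ i < suc n ] (f (toℕ i) * g (n ∸ toℕ i))

  _·_ : Carrier → FPS → FPS
  (a · f) n = a * f n

  𝟏 z 1/[1-z] : FPS
  𝟏 zero    = 1#
  𝟏 (suc _) = 0#

  z zero          = 0#
  z (suc zero)    = 1#
  z (suc (suc _)) = 0#

  1/[1-z] _ = 1#

  [1-z]⊛1/[1-z]≋𝟏 : (𝟏 ⊖ z) ⊛ 1/[1-z] ≋ 𝟏
  [1-z]⊛1/[1-z]≋𝟏 = proof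
    where
    open import Algebra.Properties.Ring ring using (-0#≈0#)
    open import Algebra.Properties.Semiring.Sum semiring
      using (sum-cong-≋; sum-replicate-zero)
    1-0≈1 : (1# - 0#) * 1# ≈ 1#
    1-0≈1 = trans (*-identityʳ _) (trans (+-congˡ -0#≈0#) (+-identityʳ 1#))
    proof : (𝟏 ⊖ z) ⊛ 1/[1-z] ≋ 𝟏
    proof zero    = trans (+-identityʳ _) 1-0≈1
    proof (suc n) = trans (+-cong 1-0≈1
      (trans (+-cong (trans (*-identityʳ _) (+-identityˡ _))
                     (trans (sum-cong-≋ {n} (λ _ → trans (*-identityʳ _) (-‿inverseʳ 0#)))
                            (sum-replicate-zero n)))
             (+-identityʳ _)))
      (-‿inverseʳ 1#)

  -- The series ∑_{i ≥ 1} aᵢ zⁱ.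
  ∑z^ : (∀ i → .{{NonZero i}} → Carrier) → FPS
  ∑z^ a zero    = 0#
  ∑z^ a (suc i) = a (suc i)

  -- f ⟨ a z⟩ is the series f(az).
  _⟨_z⟩ : FPS → Carrier → FPS
  (f ⟨ a z⟩) n = f n * a ^ n

  S : ∀ k → .{{NonTrivial k}} → FPS
  S k = ∑z^ (λ i → s k i)

module Submission where

-- Between two diagonals one box lags behind while the other κ = k − 1 boxes stay
-- balanced, so up to symmetry a state is given by the level l of the lagging box
-- and the excess d of the total over k l.  A p-side toss lowers d by 1, a q-side
-- toss lowers l by 1 and raises d by κ, and the first toss after a diagonal leads to
-- d = κ whatever its outcome.  Hence P(Y = i) = s_i p^{κi} q^{i−1} for i < n, where
-- s_i counts the paths with steps −1 and +κ that first reach 0 after i − 1 steps +κ,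
-- and E[Y] = n − Σ_{i<n} (n − i) P(Y = i).  In terms of series this is the product
-- with z/(1−z)² = Σ n zⁿ.

open import Defs
open import Algebra.Bundles using (CommutativeRing)
open import Data.Fin.Base using (Fin; toℕ; opposite)
import Data.Fin.Permutation as Perm
import Data.Fin.Properties as Finₚ
open import Data.Nat.Base as ℕ using (ℕ; zero; suc; _∸_; _≤_; NonZero; NonTrivial; >-nonZero)
open import Data.Nat.Combinatorics using (_C_)
import Data.Nat.Properties as ℕₚ
import Data.Nat.Tactic.RingSolver as ℕ-Solver
open import Data.Product.Base using (_×_; _,_)
open import Data.Vec.Base using (Vec; []; _∷_; toList)
open import Relation.Binary.PropositionalEquality as ≡ using (_≡_)

-- Lattice paths and their closed form

module LatticePaths where
  open import Data.Nat.Base using (_+_; _*_)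
  open import Data.Nat.Combinatorics using (nC1≡n; nCk+nC[k+1]≡[n+1]C[k+1])
  open import Data.Nat.Properties
  open import Data.Nat.Tactic.RingSolver using (solve-∀)
  open import Relation.Binary.PropositionalEquality
    using (refl; sym; trans; cong; cong₂; subst; module ≡-Reasoning)

  C-absorption : ∀ n k → suc k * (suc n C suc k) ≡ suc n * (n C k)
  C-absorption zero    zero    = refl
  C-absorption zero    (suc k) = *-zeroʳ (suc (suc k))
  C-absorption (suc n) zero    =
    trans (*-identityˡ (suc (suc n) C 1)) (trans (nC1≡n (suc (suc n))) (sym (*-identityʳ (suc (suc n)))))
  C-absorption (suc n) (suc k) = begin
    suc (suc k) * (suc (suc n) C suc (suc k))
      ≡⟨ cong (suc (suc k) *_) (nCk+nC[k+1]≡[n+1]C[k+1] (suc n) (suc k)) ⟨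
    suc (suc k) * (a + b)
      ≡⟨ lemma k a b ⟩
    a + (suc k * a + suc (suc k) * b)
      ≡⟨ cong (a +_) (cong₂ _+_ (C-absorption n k) (C-absorption n (suc k))) ⟩
    a + (suc n * (n C k) + suc n * (n C suc k))
      ≡⟨ cong (a +_) (*-distribˡ-+ (suc n) (n C k) (n C suc k)) ⟨
    a + suc n * (n C k + n C suc k)
      ≡⟨ cong (λ x → a + suc n * x) (nCk+nC[k+1]≡[n+1]C[k+1] n k) ⟩
    suc (suc n) * a ∎
    where
    open ≡-Reasoning
    a = suc n C suc k
    b = suc n C suc (suc k)
    lemma : ∀ k a b → suc (suc k) * (a + b) ≡ a + (suc k * a + suc (suc k) * b)
    lemma = solve-∀

  -- Pascal's rule splits the absorption identity; cancelling the common `suc k * (n C k)` leaves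
  -- the ratio of neighbouring binomials.
  C-succ-ratio : ∀ {n} k r → suc n ≡ suc k + r → suc k * (n C suc k) ≡ r * (n C k)
  C-succ-ratio {n} k r eq = +-cancelˡ-≡ (suc k * (n C k)) _ _ (begin
    suc k * (n C k) + suc k * (n C suc k)  ≡⟨ *-distribˡ-+ (suc k) (n C k) (n C suc k) ⟨
    suc k * (n C k + n C suc k)            ≡⟨ cong (suc k *_) (nCk+nC[k+1]≡[n+1]C[k+1] n k) ⟩
    suc k * (suc n C suc k)                ≡⟨ C-absorption n k ⟩
    suc n * (n C k)                        ≡⟨ cong (_* (n C k)) eq ⟩
    (suc k + r) * (n C k)                  ≡⟨ *-distribʳ-+ (n C k) (suc k) r ⟩
    suc k * (n C k) + r * (n C k)          ∎)
    where open ≡-Reasoning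

  -- Counts the paths with steps −1 and +κ that start at height d, reach height 0
  -- only at their end, and have j steps +κ; the recursion removes the first step.
  paths : (κ d j : ℕ) → ℕ
  paths κ d       zero    = 1
  paths κ zero    (suc j) = 0
  paths κ (suc d) (suc j) = paths κ d (suc j) + paths κ (suc d + κ) j

  -- The closed form  paths κ d j = d / (d + kj) · C(d + kj, j),  k = κ + 1, equals
  -- C(m, j) − κ C(m, j − 1)  with  m = d + kj − 1;  in this shape the recursion of
  -- paths is just Pascal's rule.
  paths+κ*C≡C : ∀ κ d j → let m = d + suc κ * j + κ in
    paths κ d (suc j) + κ * (m C j) ≡ m C suc j
  -- The path count vanishes here, so the two binomials must have ratio exactly κ.
  paths+κ*C≡C κ zero j = *-cancelˡ-≡ _ _ (suc j) (begin
    suc j * (κ * (m C j))  ≡⟨ lemma₁ j κ (m C j) ⟩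
    κ * suc j * (m C j)    ≡⟨ C-succ-ratio j (κ * suc j) (lemma₂ κ j) ⟨
    suc j * (m C suc j)    ∎)
    where
    open ≡-Reasoning
    m = suc κ * j + κ
    lemma₁ : ∀ j κ x → suc j * (κ * x) ≡ κ * suc j * x
    lemma₁ = solve-∀
    lemma₂ : ∀ κ j → suc (suc κ * j + κ) ≡ suc j + κ * suc j
    lemma₂ = solve-∀
  paths+κ*C≡C κ (suc d) zero = begin
    paths κ d 1 + 1 + κ * 1     ≡⟨ lemma (paths κ d 1) κ ⟩
    suc (paths κ d 1 + κ * 1)   ≡⟨ cong suc (paths+κ*C≡C κ d 0) ⟩
    suc (m C 1)                 ≡⟨ cong suc (nC1≡n m) ⟩
    suc m                       ≡⟨ nC1≡n (suc m) ⟨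
    suc m C 1                   ∎
    where
    open ≡-Reasoning
    m = d + suc κ * 0 + κ
    lemma : ∀ x κ → x + 1 + κ * 1 ≡ suc (x + κ * 1)
    lemma = solve-∀
  paths+κ*C≡C κ (suc d) (suc j) = begin
    a + b + κ * (suc m C suc j)           ≡⟨ cong (λ x → a + b + κ * x) (nCk+nC[k+1]≡[n+1]C[k+1] m j) ⟨
    a + b + κ * (m C j + m C suc j)       ≡⟨ lemma₁ a b κ (m C j) (m C suc j) ⟩
    (b + κ * (m C j)) + (a + κ * (m C suc j))
      -- Height `suc d + κ` at `j` and height `d` at `suc j` share the same `m`, so the two
      -- induction hypotheses add up by Pascal's rule.
      ≡⟨ cong₂ _+_ (subst (λ m → b + κ * (m C j) ≡ m C suc j) (lemma₂ κ d j) (paths+κ*C≡C κ (suc d + κ) j))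
                   (paths+κ*C≡C κ d (suc j)) ⟩
    m C suc j + m C suc (suc j)           ≡⟨ nCk+nC[k+1]≡[n+1]C[k+1] m (suc j) ⟩
    suc m C suc (suc j)                   ∎
    where
    open ≡-Reasoning
    a = paths κ d (suc (suc j))
    b = paths κ (suc d + κ) (suc j)
    m = d + suc κ * suc j + κ
    lemma₁ : ∀ a b κ x y → a + b + κ * (x + y) ≡ (b + κ * x) + (a + κ * y)
    lemma₁ = solve-∀
    lemma₂ : ∀ κ d j → suc d + κ + suc κ * j + κ ≡ d + suc κ * suc j + κ
    lemma₂ = solve-∀

  -- The closed form cleared of denominators. After adding `suc κ * suc j * x` to both sides,
  -- absorption makes `suc j * x` a multiple of `suc m`; once `suc m` is factored out, `paths+κ*C≡C`
  -- and Pascal's rule finish.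
  m*paths≡d*C : ∀ κ d j → let m = d + suc κ * j in m * paths κ d j ≡ d * (m C j)
  m*paths≡d*C κ d zero    = cong (_* 1) (trans (cong (d +_) (*-zeroʳ (suc κ))) (+-identityʳ d))
  m*paths≡d*C κ d (suc j) =
    subst (λ m → m * paths κ d (suc j) ≡ d * (m C suc j)) (lemma₀ κ d j)
      (+-cancelʳ-≡ (suc κ * suc j * x) _ _ (begin
        suc m * c + suc κ * suc j * x               ≡⟨ lemma₁ (suc m * c) κ j x ⟩
        suc m * c + κ * (suc j * x) + suc j * x     ≡⟨ cong (λ y → suc m * c + κ * y + y) (C-absorption m j) ⟩
        suc m * c + κ * (suc m * (m C j)) + suc m * (m C j)
                                                    ≡⟨ lemma₂ (suc m) c κ (m C j) ⟩
        suc m * ((m C j) + (c + κ * (m C j)))       ≡⟨ cong (λ y → suc m * ((m C j) + y)) (paths+κ*C≡C κ d j) ⟩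
        suc m * (m C j + m C suc j)                 ≡⟨ cong (suc m *_) (nCk+nC[k+1]≡[n+1]C[k+1] m j) ⟩
        suc m * x                                   ≡⟨ cong (_* x) (lemma₀ κ d j) ⟩
        (d + suc κ * suc j) * x                     ≡⟨ *-distribʳ-+ x d (suc κ * suc j) ⟩
        d * x + suc κ * suc j * x                   ∎))
    where
    open ≡-Reasoning
    m = d + suc κ * j + κ
    c = paths κ d (suc j)
    x = suc m C suc j
    lemma₀ : ∀ κ d j → suc (d + suc κ * j + κ) ≡ d + suc κ * suc j
    lemma₀ = solve-∀
    lemma₁ : ∀ a κ j x → a + suc κ * suc j * x ≡ a + κ * (suc j * x) + suc j * x
    lemma₁ = solve-∀
    lemma₂ : ∀ n c κ y → n * c + κ * (n * y) + n * y ≡ n * (y + (c + κ * y))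
    lemma₂ = solve-∀

-- The process seen through its lagging box

module LaggingBox where
  open import Data.Fin.Base using (zero; suc)
  open import Data.List.Base using (List; []; _∷_; length; find; applyUpTo)
  open import Data.List.Membership.Propositional using (_∈_)
  open import Data.List.Properties using (map-upTo)
  open import Data.List.Relation.Unary.Any using (here; there)
  open import Data.Maybe.Base using (just; nothing; fromMaybe)
  open import Data.Nat.Base using (_+_; _*_; _<_; pred; z≤n; s≤s; s≤s⁻¹; z<s; s<s)
  open import Data.Nat.Properties
  open import Data.Nat.Tactic.RingSolver using (solve-∀)
  open import Data.Vec.Base as Vec using (lookup; replicate; _[_]%=_)
  open import Data.Vec.Properties using (lookup-replicate; lookup∘updateAt; lookup∘updateAt′; length-toList)
  open import Data.Vec.Relation.Unary.Any as VecAny using (any?)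
  open import Data.Vec.Relation.Unary.Any.Properties using (lookup-index)
  open import Function.Base using (_∘_)
  open import Relation.Binary.PropositionalEquality
  open import Relation.Nullary using (¬_; yes; no; contradiction)
  open import Relation.Unary using (Pred; Decidable)

  find-applyUpTo-just : ∀ {a p} {A : Set a} {P : Pred A p} (P? : Decidable P) (f : ℕ → A) {n m} →
    m < n → P (f m) → (∀ {j} → j < m → ¬ P (f j)) → find P? (applyUpTo f n) ≡ just (f m)
  find-applyUpTo-just P? f {suc n} {zero} _ Pm _ with P? (f 0)
  ... | yes _ = refl
  ... | no ¬P = contradiction Pm ¬P
  find-applyUpTo-just P? f {suc n} {suc m} (s≤s m<n) Pm ¬P with P? (f 0)
  ... | yes P0 = contradiction P0 (¬P z<s)
  ... | no _  = find-applyUpTo-just P? (f ∘ suc) m<n Pm (¬P ∘ s<s)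

  find-applyUpTo-nothing : ∀ {a p} {A : Set a} {P : Pred A p} (P? : Decidable P) (f : ℕ → A) n →
    (∀ {j} → j < n → ¬ P (f j)) → find P? (applyUpTo f n) ≡ nothing
  find-applyUpTo-nothing P? f zero    ¬P = refl
  find-applyUpTo-nothing P? f (suc n) ¬P with P? (f 0)
  ... | yes P0 = contradiction P0 (¬P z<s)
  ... | no _  = find-applyUpTo-nothing P? (f ∘ suc) n (¬P ∘ s<s)

  sum-replicate : ∀ k m → Vec.sum (replicate k m) ≡ k * m
  sum-replicate zero    m = refl
  sum-replicate (suc k) m = cong (m +_) (sum-replicate k m)

  sum-pred : ∀ {k} (s : State k) j → 0 < lookup s j → suc (Vec.sum (s [ j ]%= pred)) ≡ Vec.sum s
  sum-pred (suc x ∷ s) zero    _ = refl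
  sum-pred (x ∷ s)     (suc j) p = trans (sym (+-suc x _)) (cong (x +_) (sum-pred s j p))

  sum-lower : ∀ {k m} (s : State k) → (∀ i → m ≤ lookup s i) → k * m ≤ Vec.sum s
  sum-lower []      m≤s = z≤n
  sum-lower (x ∷ s) m≤s = +-mono-≤ (m≤s zero) (sum-lower s (m≤s ∘ suc))

  sum-upper : ∀ {k m} (s : State k) → (∀ i → lookup s i ≤ m) → Vec.sum s ≤ k * m
  sum-upper []      s≤m = z≤n
  sum-upper (x ∷ s) s≤m = +-mono-≤ (s≤m zero) (sum-upper s (s≤m ∘ suc))

  -- The tail alone contributes at least `k * m`, which leaves at most `m` for the head.
  sum-lower-tight : ∀ {k m} (s : State k) → (∀ i → m ≤ lookup s i) → Vec.sum s ≡ k * m → s ≡ replicate k m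
  sum-lower-tight []      m≤s eq = refl
  sum-lower-tight {suc k} {m} (x ∷ s) m≤s eq = cong₂ _∷_ x≡m
    (sum-lower-tight s (m≤s ∘ suc) (+-cancelˡ-≡ x _ _ (trans eq (cong (_+ k * m) (sym x≡m)))))
    where
    x≡m : x ≡ m
    x≡m = ≤-antisym
      (+-cancelʳ-≤ (k * m) x m (≤-trans (+-monoʳ-≤ x (sum-lower s (m≤s ∘ suc))) (≤-reflexive eq)))
      (m≤s zero)

  lookup-pred-≤ : ∀ {k} (s : State k) j i → lookup (s [ j ]%= pred) i ≤ lookup s i
  lookup-pred-≤ (x ∷ s) zero    zero    = pred[n]≤n
  lookup-pred-≤ (x ∷ s) zero    (suc i) = ≤-refl
  lookup-pred-≤ (x ∷ s) (suc j) zero    = ≤-refl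
  lookup-pred-≤ (x ∷ s) (suc j) (suc i) = lookup-pred-≤ s j i

  -- The shape of every state between two diagonals: one box has fallen behind at
  -- level l, and the others are as equal as possible.
  record Lagging {κ} (l d : ℕ) (s : State (suc κ)) : Set where
    field
      low       : Fin (suc κ)
      low-level : lookup s low ≡ l
      total     : Vec.sum s ≡ suc κ * l + d
      lower     : ∀ j → l ≤ lookup s j
      balanced  : ∀ {i j} → i ≢ low → j ≢ low → lookup s i ≤ suc (lookup s j)

  -- The lagging invariant under single steps

  module _ {κ : ℕ} where
    open Lagging

    lagging-replicate : ∀ l → Lagging l 0 (replicate (suc κ) l)
    lagging-replicate l = record
      -- On a diagonal every box is a lowest one, so the index is an arbitrary choice.
      { low       = zero
      ; low-level = refl
      ; total     = trans (sum-replicate (suc κ) l) (sym (+-identityʳ _))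
      ; lower     = λ j → ≤-reflexive (sym (lookup-replicate j l))
      ; balanced  = λ {i} {j} _ _ →
          m≤n⇒m≤1+n (≤-reflexive (trans (lookup-replicate i l) (sym (lookup-replicate j l))))
      }

    lagging-0⇒replicate : ∀ {l} {s : State (suc κ)} → Lagging l 0 s → s ≡ replicate (suc κ) l
    lagging-0⇒replicate {s = s} L = sum-lower-tight s (lower L) (trans (total L) (+-identityʳ _))

    -- On a diagonal the low box fixes the common level, and then there is no room for a positive
    -- excess.
    lagging-suc⇒≢replicate : ∀ {l d m} {s : State (suc κ)} → Lagging l (suc d) s → replicate (suc κ) m ≢ s
    lagging-suc⇒≢replicate {l} {d} {m} L refl = m≢1+m+n (suc κ * m) (begin
      suc κ * m                        ≡⟨ sum-replicate (suc κ) m ⟨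
      Vec.sum (replicate (suc κ) m)    ≡⟨ total L ⟩
      suc κ * l + suc d                ≡⟨ cong (λ x → suc κ * x + suc d) l≡m ⟩
      suc κ * m + suc d                ≡⟨ +-suc (suc κ * m) d ⟩
      suc (suc κ * m + d)              ∎)
      where
      open ≡-Reasoning
      l≡m : l ≡ m
      l≡m = trans (sym (low-level L)) (lookup-replicate (low L) m)

    -- A positive excess forces the largest box strictly above the low level. Hence it is not the
    -- low box, and it stays at or above that level after losing a match.
    lagging-max : ∀ {l d} {s : State (suc κ)} {j} → Lagging (suc l) (suc d) s →
      (∀ i → lookup s i ≤ lookup s j) → Lagging (suc l) d (s [ j ]%= pred)
    lagging-max {l} {d} {s} {j} L s≤sⱼ = record
      { low       = low L
      ; low-level = trans (other (≢-sym j≢low)) (low-level L)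
      ; total     = suc-injective (trans (sum-pred s j (<-trans z<s l<sⱼ)) (trans (total L) (+-suc _ d)))
      ; lower     = lower′
      ; balanced  = balanced′
      }
      where
      l<sⱼ : suc l < lookup s j
      l<sⱼ = ≰⇒> λ sⱼ≤l → <⇒≱ (m<m+n (suc κ * suc l) z<s)
        (≤-trans (≤-reflexive (sym (total L))) (sum-upper s (λ i → ≤-trans (s≤sⱼ i) sⱼ≤l)))
      j≢low : j ≢ low L
      j≢low refl = <-irrefl (sym (low-level L)) l<sⱼ
      other : ∀ {i} → i ≢ j → lookup (s [ j ]%= pred) i ≡ lookup s i
      other {i} i≢j = lookup∘updateAt′ i j i≢j s
      lower′ : ∀ i → suc l ≤ lookup (s [ j ]%= pred) i
      lower′ i with i Finₚ.≟ j
      ... | yes refl = ≤-trans (pred-mono-≤ l<sⱼ) (≤-reflexive (sym (lookup∘updateAt j s)))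
      ... | no i≢j   = ≤-trans (lower L i) (≤-reflexive (sym (other i≢j)))
      balanced′ : ∀ {i i′} → i ≢ low L → i′ ≢ low L →
        lookup (s [ j ]%= pred) i ≤ suc (lookup (s [ j ]%= pred) i′)
      balanced′ {i} {i′} i≢low i′≢low with i′ Finₚ.≟ j
      ... | yes refl = begin
        lookup (s [ j ]%= pred) i         ≤⟨ lookup-pred-≤ s j i ⟩
        lookup s i                        ≤⟨ s≤sⱼ i ⟩
        lookup s j                        ≡⟨ suc-pred (lookup s j) {{>-nonZero (<-trans z<s l<sⱼ)}} ⟨
        suc (pred (lookup s j))           ≡⟨ cong suc (lookup∘updateAt j s) ⟨
        suc (lookup (s [ j ]%= pred) j)   ∎
        where open ≤-Reasoning
      ... | no i′≢j  = ≤-trans (lookup-pred-≤ s j i) (≤-trans (balanced L i≢low i′≢low)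
                         (≤-reflexive (cong suc (sym (other i′≢j)))))

    -- The smallest box `j` is at the level of the old low box, perhaps without being it, and
    -- becomes the new low box. One match fewer over a base lowered by `suc κ` raises the excess by
    -- κ.
    lagging-min : ∀ {l d} {s : State (suc κ)} {j} → Lagging (suc l) d s →
      (∀ i → lookup s j ≤ lookup s i) → Lagging l (d + κ) (s [ j ]%= pred)
    lagging-min {l} {d} {s} {j} L sⱼ≤s = record
      { low       = j
      ; low-level = sⱼ′≡l
      ; total     = suc-injective (trans (sum-pred s j (subst (0 <_) (sym sⱼ≡l) z<s)) (trans (total L) (lemma κ l d)))
      ; lower     = lower′
      ; balanced  = λ i≢j i′≢j → subst₂ (λ x y → x ≤ suc y) (sym (other i≢j)) (sym (other i′≢j)) (balanced′ i≢j i′≢j)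
      }
      where
      lemma : ∀ κ l d → suc κ * suc l + d ≡ suc (suc κ * l + (d + κ))
      lemma = solve-∀
      sⱼ≡l : lookup s j ≡ suc l
      sⱼ≡l = ≤-antisym (≤-trans (sⱼ≤s (low L)) (≤-reflexive (low-level L))) (lower L j)
      sⱼ′≡l : lookup (s [ j ]%= pred) j ≡ l
      sⱼ′≡l = trans (lookup∘updateAt j s) (cong pred sⱼ≡l)
      other : ∀ {i} → i ≢ j → lookup (s [ j ]%= pred) i ≡ lookup s i
      other {i} i≢j = lookup∘updateAt′ i j i≢j s
      lower′ : ∀ i → l ≤ lookup (s [ j ]%= pred) i
      lower′ i with i Finₚ.≟ j
      ... | yes refl = ≤-reflexive (sym sⱼ′≡l)
      ... | no i≢j   = ≤-trans (n≤1+n l) (≤-trans (lower L i) (≤-reflexive (sym (other i≢j))))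
      balanced′ : ∀ {i i′} → i ≢ j → i′ ≢ j → lookup s i ≤ suc (lookup s i′)
      balanced′ {i} {i′} i≢j i′≢j with i Finₚ.≟ low L | i′ Finₚ.≟ low L
      ... | yes refl | _        = m≤n⇒m≤1+n (≤-trans (≤-reflexive (low-level L)) (lower L i′))
      ... | no i≢low | no i′≢low = balanced L i≢low i′≢low
      -- The old low box now counts among the others; the comparison with it goes through box `j`,
      -- which is no larger.
      ... | no i≢low | yes refl = ≤-trans (balanced L i≢low (≢-sym i′≢j)) (s≤s (sⱼ≤s i′))

    module _ (τ : TieBreaking (suc κ)) where
      open TieBreaking τ

      step-nonempty : ∀ past s c → (∀ i → 0 < lookup s i) → step τ past s c ≡ s [ chosen τ past s c ]%= pred
      step-nonempty past s c 0<s with any? (_≟ 0) s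
      ... | yes e = contradiction (lookup-index e) (>⇒≢ (0<s (VecAny.index e)))
      ... | no  _ = refl

      step-≤ : ∀ past s c i → lookup (step τ past s c) i ≤ lookup s i
      step-≤ past s c i with any? (_≟ 0) s
      ... | yes _ = ≤-refl
      ... | no  _ = lookup-pred-≤ s _ i

      lagging-step-p : ∀ {l d past s} → Lagging (suc l) (suc d) s → Lagging (suc l) d (step τ past s p-side)
      lagging-step-p {past = past} {s} L = subst (Lagging _ _)
        (sym (step-nonempty past s p-side (λ i → ≤-trans z<s (lower L i)))) (lagging-max L (largest-max past s))

      lagging-step-q : ∀ {l d past s} → Lagging (suc l) d s → Lagging l (d + κ) (step τ past s q-side)
      lagging-step-q {past = past} {s} L = subst (Lagging _ _)
        (sym (step-nonempty past s q-side (λ i → ≤-trans z<s (lower L i)))) (lagging-min L (smallest-min past s))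

      -- On a diagonal every box is also a smallest one, so either outcome of the toss is an
      -- instance of `lagging-min` with excess 0.
      lagging-step-replicate : ∀ l past c → Lagging l κ (step τ past (replicate (suc κ) (suc l)) c)
      lagging-step-replicate l past c = subst (Lagging l κ)
        (sym (step-nonempty past s c (λ i → ≤-trans z<s (≤-reflexive (sym (lookup-replicate i (suc l)))))))
        (lagging-min {d = 0} (lagging-replicate (suc l)) (λ i →
          ≤-reflexive (trans (lookup-replicate (chosen τ past s c) (suc l)) (sym (lookup-replicate i (suc l))))))
        where s = replicate (suc κ) (suc l)

      head∈trajectory : ∀ past s cs → s ∈ trajectory τ past s cs
      head∈trajectory past s []       = here refl
      head∈trajectory past s (c ∷ cs) = here refl

      -- Entries never increase along a trajectory.
      ∈trajectory⇒≤ : ∀ {m} past s cs → replicate (suc κ) m ∈ trajectory τ past s cs → ∀ i → m ≤ lookup s i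
      ∈trajectory⇒≤ past s []       (here refl) i = ≤-reflexive (sym (lookup-replicate i _))
      ∈trajectory⇒≤ past s (c ∷ cs) (here refl) i = ≤-reflexive (sym (lookup-replicate i _))
      ∈trajectory⇒≤ past s (c ∷ cs) (there m∈)  i =
        ≤-trans (∈trajectory⇒≤ (c ∷ past) (step τ past s c) cs m∈ i) (step-≤ past s c i)

  -- The level l of the lagging box when the boxes first become equal (d = 0) or that
  -- box becomes empty; junk if the tosses run out before that.
  stopLevel : (κ l d : ℕ) → List Coin → ℕ
  stopLevel κ zero    d       cs            = 0
  stopLevel κ (suc l) zero    cs            = suc l
  stopLevel κ (suc l) (suc d) []            = 0
  stopLevel κ (suc l) (suc d) (p-side ∷ cs) = stopLevel κ (suc l) d cs
  stopLevel κ (suc l) (suc d) (q-side ∷ cs) = stopLevel κ l (suc d + κ) cs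

  stopLevel≤ : ∀ κ l d cs → stopLevel κ l d cs ≤ l
  stopLevel≤ κ zero    d       cs            = z≤n
  stopLevel≤ κ (suc l) zero    cs            = ≤-refl
  stopLevel≤ κ (suc l) (suc d) []            = z≤n
  stopLevel≤ κ (suc l) (suc d) (p-side ∷ cs) = stopLevel≤ κ (suc l) d cs
  stopLevel≤ κ (suc l) (suc d) (q-side ∷ cs) = m≤n⇒m≤1+n (stopLevel≤ κ l (suc d + κ) cs)

  -- `suc κ * l + d` is the number of matches left. Each toss before the stop removes one of them,
  -- so a sufficient supply of tosses stays sufficient.
  tosses-q : ∀ κ l d {N} → suc κ * suc l + d ≤ suc N → suc κ * l + (d + κ) ≤ N
  tosses-q κ l d {N} le = s≤s⁻¹ (subst (_≤ suc N) (lemma κ l d) le)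
    where
    lemma : ∀ κ l d → suc κ * suc l + d ≡ suc (suc κ * l + (d + κ))
    lemma = solve-∀

  tosses-p : ∀ κ l d {N} → suc κ * l + suc d ≤ suc N → suc κ * l + d ≤ N
  tosses-p κ l d {N} le = s≤s⁻¹ (subst (_≤ suc N) (+-suc (suc κ * l) d) le)

  -- Diagonals on a trajectory and the value of Y

  module _ {κ : ℕ} (τ : TieBreaking (suc κ)) where
    open Lagging

    -- Before the stop the excess is positive, so no state is diagonal; from the stop on, the low
    -- box bounds every diagonal level.
    ∈trajectory⇒≤stopLevel : ∀ {l d m past s} cs → Lagging l d s →
      replicate (suc κ) m ∈ trajectory τ past s cs → m ≤ stopLevel κ l d cs
    ∈trajectory⇒≤stopLevel {zero} cs L m∈ =
      ≤-trans (∈trajectory⇒≤ τ _ _ cs m∈ (low L)) (≤-reflexive (low-level L))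
    ∈trajectory⇒≤stopLevel {suc l} {zero} cs L m∈ =
      ≤-trans (∈trajectory⇒≤ τ _ _ cs m∈ (low L)) (≤-reflexive (low-level L))
    ∈trajectory⇒≤stopLevel {suc l} {suc d} []            L (here eq)  = contradiction eq (lagging-suc⇒≢replicate L)
    ∈trajectory⇒≤stopLevel {suc l} {suc d} (c ∷ cs)      L (here eq)  = contradiction eq (lagging-suc⇒≢replicate L)
    ∈trajectory⇒≤stopLevel {suc l} {suc d} (p-side ∷ cs) L (there m∈) = ∈trajectory⇒≤stopLevel cs (lagging-step-p τ L) m∈
    ∈trajectory⇒≤stopLevel {suc l} {suc d} (q-side ∷ cs) L (there m∈) = ∈trajectory⇒≤stopLevel cs (lagging-step-q τ L) m∈

    -- A positive stop level comes only from excess 0, where the state is the diagonal itself.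
    stopLevel∈trajectory : ∀ {l d past s} cs → Lagging l d s → suc κ * l + d ≤ length cs → 0 < stopLevel κ l d cs →
      replicate (suc κ) (stopLevel κ l d cs) ∈ trajectory τ past s cs
    stopLevel∈trajectory {suc l} {zero}  {past} {s} cs L _ _ =
      subst (_∈ trajectory τ past s cs) (lagging-0⇒replicate L) (head∈trajectory τ past s cs)
    stopLevel∈trajectory {suc l} {suc d} (p-side ∷ cs) L le 0<st =
      there (stopLevel∈trajectory cs (lagging-step-p τ L) (tosses-p κ (suc l) d le) 0<st)
    stopLevel∈trajectory {suc l} {suc d} (q-side ∷ cs) L le 0<st =
      there (stopLevel∈trajectory cs (lagging-step-q τ L) (tosses-q κ l (suc d) le) 0<st)

    -- The search visits the levels `n`, `n ∸ 1`, ..., 1 in decreasing order, so its first hit is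
    -- the highest diagonal after the start, which is the one at the stop level.
    Y≡n∸stopLevel : ∀ n c (ω : Vec Coin (n + κ * suc n)) →
      Y τ (suc n) (c ∷ ω) ≡ suc n ∸ stopLevel κ n κ (toList ω)
    Y≡n∸stopLevel n c ω = trans (cong (λ is → fromMaybe (suc n) (find P? is)) (map-upTo suc n)) find≡
      where
      cs = toList ω
      st = stopLevel κ n κ cs
      P? = λ i → hitsDiagonal? τ (suc n) (c ∷ ω) (suc n ∸ i)
      L : Lagging n κ (step τ [] (replicate (suc κ) (suc n)) c)
      L = lagging-step-replicate τ n [] c
      hits⇒≤stopLevel : ∀ i → HitsDiagonal τ (suc n) (c ∷ ω) (suc n ∸ suc i) → n ∸ i ≤ st
      -- The initial diagonal has level `suc n`, above every level searched.
      hits⇒≤stopLevel i (here eq) = contradiction (cong (λ s → lookup s zero) eq) (<⇒≢ (s≤s (m∸n≤m n i)))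
      hits⇒≤stopLevel i (there h) = ∈trajectory⇒≤stopLevel cs L h
      find≡ : fromMaybe (suc n) (find P? (applyUpTo suc n)) ≡ suc n ∸ st
      find≡ with st in st≡
      -- All levels searched are positive, so nothing is found and the default `suc n` is returned.
      ... | zero  = cong (fromMaybe (suc n)) (find-applyUpTo-nothing P? suc n (λ {j} j<n h →
                      <⇒≱ (m<n⇒0<n∸m j<n) (≤-trans (hits⇒≤stopLevel j h) (≤-reflexive st≡))))
      -- The hit is at position `n ∸ suc t`, whose level is `suc t`; earlier positions stand for
      -- higher levels.
      ... | suc t = trans (cong (fromMaybe (suc n)) (find-applyUpTo-just P? suc (∸-monoʳ-< z<s st≤n)
                      (subst (HitsDiagonal τ (suc n) (c ∷ ω)) (trans st≡ (sym (m∸[m∸n]≡n st≤n)))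
                        (there (stopLevel∈trajectory cs L tosses (subst (0 <_) (sym st≡) z<s))))
                      (λ {j} j<m h → <⇒≱ (earlier j<m) (≤-trans (hits⇒≤stopLevel j h) (≤-reflexive st≡)))))
                    (sym (+-∸-assoc 1 st≤n))
        where
        st≤n : suc t ≤ n
        st≤n = subst (_≤ n) st≡ (stopLevel≤ κ n κ cs)
        earlier : ∀ {j} → j < n ∸ suc t → suc t < n ∸ j
        earlier {j} j<m = m+n≤o⇒m≤o∸n (suc (suc t)) (subst (_≤ n) (lemma j t) (m≤o∸n⇒m+n≤o (suc j) st≤n j<m))
          where
          lemma : ∀ j t → suc j + suc t ≡ suc (suc t) + j
          lemma = solve-∀
        tosses : suc κ * n + κ ≤ length cs
        tosses = ≤-reflexive (trans (lemma κ n) (sym (length-toList ω)))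
          where
          lemma : ∀ κ n → suc κ * n + κ ≡ n + κ * suc n
          lemma = solve-∀

open LatticePaths using (paths; m*paths≡d*C)
open LaggingBox using (stopLevel; tosses-p; tosses-q; Y≡n∸stopLevel)

-- Natural numbers in the field and the coefficients s

module _ {c ℓ₁ ℓ₂} (ℝ : RealNumbers c ℓ₁ ℓ₂) where
  open RealNumbers ℝ
  open Matchbox ℝ
  open CommutativeRing commutativeRing using (commutativeSemiring)
  open import Algebra.Properties.Ring ring
    using (-‿distribˡ-*; -‿distribʳ-*; -‿+-comm; -0#≈0#)
  open import Algebra.Properties.CommutativeSemiring.Exp commutativeSemiring
    using (^-congʳ; ^-assocʳ; ^-distrib-*)
  open import Algebra.Properties.Semiring.Mult semiring using (×-homo-+; ×1-homo-*)
  open import Algebra.Properties.Semiring.Sum semiring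
    using (sum-cong-≋; sum-replicate-zero; *-distribˡ-sum; ∑-distrib-+; sum-permute)
  open import Algebra.Solver.Ring.NaturalCoefficients.Default commutativeSemiring
    using (solve; _:=_; _:+_; _:*_)
  open import Relation.Binary.Reasoning.Setoid setoid

  ι-cong : ∀ {m n} → m ≡ n → ι m ≈ ι n
  ι-cong m≡n = reflexive (≡.cong ι m≡n)

  x-0≈x : ∀ x → x - 0# ≈ x
  x-0≈x x = trans (+-congˡ -0#≈0#) (+-identityʳ x)

  [x+y]-y≈x : ∀ x y → (x + y) - y ≈ x
  [x+y]-y≈x x y = trans (+-assoc x y (- y)) (trans (+-congˡ (-‿inverseʳ y)) (+-identityʳ x))

  ι-∸ : ∀ {m n} → m ≤ n → ι (n ∸ m) ≈ ι n - ι m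
  ι-∸ {m} {n} m≤n = begin
    ι (n ∸ m)                ≈⟨ [x+y]-y≈x _ _ ⟨
    ι (n ∸ m) + ι m - ι m    ≈⟨ +-congʳ (×-homo-+ 1# (n ∸ m) m) ⟨
    ι (n ∸ m ℕ.+ m) - ι m    ≈⟨ +-congʳ (ι-cong (ℕₚ.m∸n+n≡m m≤n)) ⟩
    ι n - ι m                ∎

  sum-zero : ∀ n {f : Fin n → Carrier} → (∀ i → f i ≈ 0#) → sum f ≈ 0#
  sum-zero n f≈0 = trans (sum-cong-≋ f≈0) (sum-replicate-zero n)

  sum-reverse : ∀ n (f : ℕ → Carrier) → ∑[ i < suc n ] f (toℕ i) ≈ ∑[ i < suc n ] f (n ∸ toℕ i)
  sum-reverse n f = trans (sum-permute {suc n} {suc n} (λ i → f (toℕ i)) Perm.reverse)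
    (sum-cong-≋ {suc n} {λ i → f (toℕ (opposite i))} {λ i → f (n ∸ toℕ i)}
      (λ i → reflexive (≡.cong f (Finₚ.opposite-prop i))))

  /ᴺ-* : ∀ m .{{_ : NonZero m}} x y w → x * y ≈ w * ι m → (x /ᴺ m) * y ≈ w
  /ᴺ-* (suc m) x y w eq = begin
    (x * m⁻¹) * y             ≈⟨ solve 3 (λ a b c → (a :* b) :* c := (a :* c) :* b) refl x m⁻¹ y ⟩
    (x * y) * m⁻¹             ≈⟨ *-congʳ eq ⟩
    (w * ι (suc m)) * m⁻¹     ≈⟨ *-assoc _ _ _ ⟩
    w * (ι (suc m) * m⁻¹)     ≈⟨ *-congˡ (*-⁻¹ _) ⟩
    w * 1#                    ≈⟨ *-identityʳ w ⟩
    w                         ∎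
    where m⁻¹ = ι (suc m) ⁻¹[ 0<ι[1+n] m ]

  -- Here `κ` is k - 2, so paths start at height k - 1 = `suc κ`. With i = `suc j`, the length d +
  -- kj in the closed form is ki - 1, and its value is the defining fraction of s.
  s≈paths : ∀ κ j → s (suc (suc κ)) (suc j) ≈ ι (paths (suc κ) (suc κ) j)
  s≈paths κ j = /ᴺ-* m {{>-nonZero (ℕₚ.≤-trans ℕ.z<s (ℕₚ.m≤n+m _ j))}} _ _ _ (begin
    ι (suc κ) * ι (m C j)                   ≈⟨ ×1-homo-* (suc κ) (m C j) ⟨
    ι (suc κ ℕ.* (m C j))                   ≈⟨ ι-cong eq ⟩
    ι (paths (suc κ) (suc κ) j ℕ.* m)       ≈⟨ ×1-homo-* (paths (suc κ) (suc κ) j) m ⟩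
    ι (paths (suc κ) (suc κ) j) * ι m       ∎)
    where
    m = j ℕ.+ suc κ ℕ.* suc j
    lemma : ∀ κ j → suc κ ℕ.+ suc (suc κ) ℕ.* j ≡ j ℕ.+ suc κ ℕ.* suc j
    lemma = ℕ-Solver.solve-∀
    eq : suc κ ℕ.* (m C j) ≡ paths (suc κ) (suc κ) j ℕ.* m
    eq = ≡.trans (≡.sym (≡.subst (λ m → m ℕ.* paths (suc κ) (suc κ) j ≡ suc κ ℕ.* (m C j))
                          (lemma κ j) (m*paths≡d*C (suc κ) (suc κ) j)))
                 (ℕₚ.*-comm m _)

  -- Expectations over coin tosses

  module _ (p : Carrier) where

    private
      q : Carrier
      q = 1# - p

    p+q≈1 : p + q ≈ 1#
    p+q≈1 = trans (+-comm p q) (trans (+-assoc 1# (- p) p) (trans (+-congˡ (-‿inverseˡ p)) (+-identityʳ 1#)))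

    mix-const : ∀ {x y a} → x ≈ a → y ≈ a → p * x + q * y ≈ a
    mix-const {x} {y} {a} x≈a y≈a = begin
      p * x + q * y   ≈⟨ +-cong (*-congˡ x≈a) (*-congˡ y≈a) ⟩
      p * a + q * a   ≈⟨ distribʳ a p q ⟨
      (p + q) * a     ≈⟨ *-congʳ p+q≈1 ⟩
      1# * a          ≈⟨ *-identityˡ a ⟩
      a               ∎

    mix-minus : ∀ a x y → p * (a - x) + q * (a - y) ≈ a - (p * x + q * y)
    mix-minus a x y = begin
      p * (a - x) + q * (a - y)
        ≈⟨ solve 5 (λ p q a x y → p :* (a :+ x) :+ q :* (a :+ y) := (p :* a :+ q :* a) :+ (p :* x :+ q :* y))
             refl p q a (- x) (- y) ⟩
      (p * a + q * a) + (p * - x + q * - y)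
        ≈⟨ +-cong (mix-const refl refl) (+-cong (sym (-‿distribʳ-* p x)) (sym (-‿distribʳ-* q y))) ⟩
      a + (- (p * x) + - (q * y))
        ≈⟨ +-congˡ (-‿+-comm (p * x) (q * y)) ⟩
      a - (p * x + q * y) ∎

    𝔼-cong : ∀ {N} {f g : Vec Coin N → Carrier} → (∀ ω → f ω ≈ g ω) → 𝔼 p f ≈ 𝔼 p g
    𝔼-cong {zero}  f≈g = f≈g []
    𝔼-cong {suc N} f≈g = +-cong (*-congˡ (𝔼-cong (λ ω → f≈g (p-side ∷ ω))))
                                (*-congˡ (𝔼-cong (λ ω → f≈g (q-side ∷ ω))))

    𝔼-const : ∀ N a → 𝔼 p {N} (λ _ → a) ≈ a
    𝔼-const zero    a = refl
    𝔼-const (suc N) a = mix-const (𝔼-const N a) (𝔼-const N a)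

    module _ (κ : ℕ) where

      -- The probability of a single path: compensating `j` q-side tosses and the initial height
      -- takes `d + κ * j` p-side tosses.
      weight : (d j : ℕ) → Carrier
      weight d j = p ^ (d ℕ.+ κ ℕ.* j) * q ^ j

      -- A walk that first reaches d = 0 after j q-side tosses stops at level l − j.
      𝔼stopLevel : (l d : ℕ) → Carrier
      𝔼stopLevel l d = ∑[ j < l ] (ι ((l ∸ toℕ j) ℕ.* paths κ d (toℕ j)) * weight d (toℕ j))

      -- From height 0 only the empty path counts, so only the term `j = 0` survives.
      𝔼stopLevel-diagonal : ∀ l → 𝔼stopLevel l 0 ≈ ι l
      𝔼stopLevel-diagonal zero    = refl
      𝔼stopLevel-diagonal (suc l) = begin
        ι (suc l ℕ.* 1) * weight 0 0 + tail
          ≈⟨ +-cong (*-cong (ι-cong (ℕₚ.*-identityʳ (suc l)))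
                            (*-congʳ (^-congʳ p (ℕₚ.*-zeroʳ κ))))
                    (sum-zero l (λ j → trans (*-congʳ (ι-cong (ℕₚ.*-zeroʳ (l ∸ toℕ j)))) (zeroˡ _))) ⟩
        ι (suc l) * (1# * 1#) + 0#
          ≈⟨ +-identityʳ _ ⟩
        ι (suc l) * (1# * 1#)
          ≈⟨ *-congˡ (*-identityʳ 1#) ⟩
        ι (suc l) * 1#
          ≈⟨ *-identityʳ _ ⟩
        ι (suc l) ∎
        where
        tail = ∑[ j < l ] (ι ((l ∸ toℕ j) ℕ.* 0) * weight 0 (suc (toℕ j)))

      -- This is conditioning on the first toss. The term `j = 0` has p-side tosses only; every
      -- other term splits by the recursion of `paths`, and its q-side part has one q-side toss
      -- fewer to go.
      𝔼stopLevel-step : ∀ l d →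
        𝔼stopLevel (suc l) (suc d) ≈ p * 𝔼stopLevel (suc l) d + q * 𝔼stopLevel l (suc d ℕ.+ κ)
      𝔼stopLevel-step l d = begin
        head′ + sum {l} (λ j → tail (toℕ j))
          ≈⟨ +-cong head-step (sum-cong-≋ {l} (λ j → tail-step (toℕ j))) ⟩
        p * head + ∑[ j < l ] (p * tail-p (toℕ j) + q * tail-q (toℕ j))
          ≈⟨ +-congˡ (∑-distrib-+ {l} _ _) ⟩
        p * head + (∑[ j < l ] (p * tail-p (toℕ j)) + ∑[ j < l ] (q * tail-q (toℕ j)))
          ≈⟨ +-congˡ (+-cong (sym (*-distribˡ-sum {l} p _)) (sym (*-distribˡ-sum {l} q _))) ⟩
        p * head + (p * sum {l} (λ j → tail-p (toℕ j)) + q * 𝔼stopLevel l (suc d ℕ.+ κ))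
          ≈⟨ +-assoc _ _ _ ⟨
        p * head + p * sum {l} (λ j → tail-p (toℕ j)) + q * 𝔼stopLevel l (suc d ℕ.+ κ)
          ≈⟨ +-congʳ (distribˡ p _ _) ⟨
        p * 𝔼stopLevel (suc l) d + q * 𝔼stopLevel l (suc d ℕ.+ κ) ∎
        where
        head′ = ι (suc l ℕ.* 1) * weight (suc d) 0
        head  = ι (suc l ℕ.* 1) * weight d 0
        tail tail-p tail-q : ℕ → Carrier
        tail   j = ι ((l ∸ j) ℕ.* paths κ (suc d) (suc j)) * weight (suc d) (suc j)
        tail-p j = ι ((l ∸ j) ℕ.* paths κ d (suc j)) * weight d (suc j)
        tail-q j = ι ((l ∸ j) ℕ.* paths κ (suc d ℕ.+ κ) j) * weight (suc d ℕ.+ κ) j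
        head-step : head′ ≈ p * head
        head-step = solve 4 (λ a p P Q → a :* (p :* P :* Q) := p :* (a :* (P :* Q))) refl
          (ι (suc l ℕ.* 1)) p (p ^ (d ℕ.+ κ ℕ.* 0)) (q ^ 0)
        tail-step : ∀ j → tail j ≈ p * tail-p j + q * tail-q j
        tail-step j = begin
          ι (m ℕ.* (a ℕ.+ b)) * (p * P * (q * Q))
            ≈⟨ *-congʳ (trans (ι-cong (ℕₚ.*-distribˡ-+ m a b)) (×-homo-+ 1# (m ℕ.* a) (m ℕ.* b))) ⟩
          (ι (m ℕ.* a) + ι (m ℕ.* b)) * (p * P * (q * Q))
            ≈⟨ solve 6 (λ x y p P q Q → (x :+ y) :* (p :* P :* (q :* Q))
                          := p :* (x :* (P :* (q :* Q))) :+ q :* (y :* (p :* P :* Q)))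
                 refl (ι (m ℕ.* a)) (ι (m ℕ.* b)) p P q Q ⟩
          p * tail-p j + q * (ι (m ℕ.* b) * (p ^ suc (d ℕ.+ κ ℕ.* suc j) * Q))
            -- The factor `p` left over is absorbed by the weight at the raised height `suc d + κ`.
            ≈⟨ +-congˡ (*-congˡ (*-congˡ (*-congʳ (^-congʳ p (lemma κ d j))))) ⟩
          p * tail-p j + q * tail-q j ∎
          where
          m = l ∸ j
          a = paths κ d (suc j)
          b = paths κ (suc d ℕ.+ κ) j
          P = p ^ (d ℕ.+ κ ℕ.* suc j)
          Q = q ^ j
          lemma : ∀ κ d j → suc (d ℕ.+ κ ℕ.* suc j) ≡ suc d ℕ.+ κ ℕ.+ κ ℕ.* j
          lemma = ℕ-Solver.solve-∀

      -- Both sides obey the same first-toss recursion and agree when `l` or `d` is 0. The bound on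
      -- `N` excludes the junk value of `stopLevel`.
      𝔼[n∸stopLevel] : ∀ {N n} l d → l ≤ n → suc κ ℕ.* l ℕ.+ d ≤ N →
        𝔼 p {N} (λ ω → ι (n ∸ stopLevel κ l d (toList ω))) ≈ ι n - 𝔼stopLevel l d
      𝔼[n∸stopLevel] {N} {n} zero d _ _ = trans (𝔼-const N (ι n)) (sym (x-0≈x (ι n)))
      𝔼[n∸stopLevel] {N} {n} (suc l) zero l≤n _ = begin
        𝔼 p {N} (λ _ → ι (n ∸ suc l))   ≈⟨ 𝔼-const N _ ⟩
        ι (n ∸ suc l)                   ≈⟨ ι-∸ l≤n ⟩
        ι n - ι (suc l)                 ≈⟨ +-congˡ (-‿cong (𝔼stopLevel-diagonal (suc l))) ⟨
        ι n - 𝔼stopLevel (suc l) 0      ∎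
      𝔼[n∸stopLevel] {suc N} {n} (suc l) (suc d) l≤n le = begin
        p * 𝔼 p {N} (λ ω → ι (n ∸ stopLevel κ (suc l) d (toList ω)))
          + q * 𝔼 p {N} (λ ω → ι (n ∸ stopLevel κ l (suc d ℕ.+ κ) (toList ω)))
          ≈⟨ +-cong (*-congˡ (𝔼[n∸stopLevel] (suc l) d l≤n (tosses-p κ (suc l) d le)))
                    (*-congˡ (𝔼[n∸stopLevel] l (suc d ℕ.+ κ) (ℕₚ.≤-trans (ℕₚ.n≤1+n l) l≤n)
                                       (tosses-q κ l (suc d) le))) ⟩
        p * (ι n - 𝔼stopLevel (suc l) d) + q * (ι n - 𝔼stopLevel l (suc d ℕ.+ κ))
          ≈⟨ mix-minus (ι n) (𝔼stopLevel (suc l) d) (𝔼stopLevel l (suc d ℕ.+ κ)) ⟩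
        ι n - (p * 𝔼stopLevel (suc l) d + q * 𝔼stopLevel l (suc d ℕ.+ κ))
          ≈⟨ +-congˡ (-‿cong (𝔼stopLevel-step l d)) ⟨
        ι n - 𝔼stopLevel (suc l) (suc d) ∎

      -- Both outcomes of the first toss leave level `n` and excess κ, so the two conditional
      -- expectations coincide.
      𝔼Y≈n-𝔼stopLevel : ∀ (τ : TieBreaking (suc κ)) n → 𝔼Y τ (suc n) p ≈ ι (suc n) - 𝔼stopLevel n κ
      𝔼Y≈n-𝔼stopLevel τ n = mix-const (after p-side) (after q-side)
        where
        N = n ℕ.+ κ ℕ.* suc n
        lemma : ∀ κ n → suc κ ℕ.* n ℕ.+ κ ≡ n ℕ.+ κ ℕ.* suc n
        lemma = ℕ-Solver.solve-∀
        after : ∀ c → 𝔼 p {N} (λ ω → ι (Y τ (suc n) (c ∷ ω))) ≈ ι (suc n) - 𝔼stopLevel n κ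
        after c = trans (𝔼-cong {N} (λ ω → ι-cong (Y≡n∸stopLevel τ n c ω)))
          (𝔼[n∸stopLevel] n κ (ℕₚ.n≤1+n n) (ℕₚ.≤-reflexive (lemma κ n)))

    -- The explicit formula, with κ = k - 2

    module _ (κ : ℕ) (p<1 : p < 1#) where
      private
        k : ℕ
        k = suc (suc κ)
        1/q = q ⁻¹[ x<y⇒0<y-x p<1 ]
        a = p ^ suc κ * q

      -- The first toss is free, so a first return at i = `suc j` has only i - 1 factors q; `1/q`
      -- cancels the surplus one in `a ^ suc j`.
      1/q*term : ∀ n j → 1/q * (ι (n ∸ j) * s k (suc j) * a ^ suc j)
        ≈ ι ((n ∸ j) ℕ.* paths (suc κ) (suc κ) j) * weight (suc κ) (suc κ) j
      1/q*term n j = begin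
        1/q * (ι m * s k (suc j) * a ^ suc j)
          ≈⟨ *-congˡ (*-cong (*-congˡ (s≈paths κ j)) a^[1+j]) ⟩
        1/q * (ι m * ι x * (P * (q * q ^ j)))
          ≈⟨ solve 6 (λ r m x P q Q → r :* (m :* x :* (P :* (q :* Q))) := (q :* r) :* ((m :* x) :* (P :* Q)))
               refl 1/q (ι m) (ι x) P q (q ^ j) ⟩
        (q * 1/q) * (ι m * ι x * (P * q ^ j))
          ≈⟨ *-cong (*-⁻¹ _) (*-congʳ (sym (×1-homo-* m x))) ⟩
        1# * (ι (m ℕ.* x) * (P * q ^ j))
          ≈⟨ *-identityˡ _ ⟩
        ι (m ℕ.* x) * (P * q ^ j) ∎
        where
        m = n ∸ j
        x = paths (suc κ) (suc κ) j
        P = p ^ (suc κ ℕ.+ suc κ ℕ.* j)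
        a^[1+j] : a ^ suc j ≈ P * (q * q ^ j)
        a^[1+j] = trans (^-distrib-* (p ^ suc κ) q (suc j))
          (*-congʳ (trans (^-assocʳ p (suc κ) (suc j)) (^-congʳ p (ℕₚ.*-suc (suc κ) j))))

      𝔼Y-formula : ∀ (τ : TieBreaking k) n → 𝔼Y τ (suc n) p ≈
        ι (suc n) - 1/q * ∑[ j < n ] (ι (n ∸ toℕ j) * s k (suc (toℕ j)) * a ^ suc (toℕ j))
      𝔼Y-formula τ n = trans (𝔼Y≈n-𝔼stopLevel (suc κ) τ n) (+-congˡ (-‿cong (begin
        𝔼stopLevel (suc κ) n (suc κ)      ≈⟨ sum-cong-≋ {n} (λ j → 1/q*term n (toℕ j)) ⟨
        ∑[ j < n ] (1/q * term (toℕ j))       ≈⟨ *-distribˡ-sum {n} 1/q (λ j → term (toℕ j)) ⟨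
        1/q * ∑[ j < n ] term (toℕ j)         ∎)))
        where
        term : ℕ → Carrier
        term j = ι (n ∸ j) * s k (suc j) * a ^ suc j

  -- The generating function

  z⊛f : ∀ (f : FPS) n → (z ⊛ f) (suc n) ≈ f n
  z⊛f f n = begin
    0# * f (suc n) + (1# * f n + ∑[ i < n ] (0# * f (n ∸ suc (toℕ i))))
      ≈⟨ +-cong (zeroˡ _) (+-cong (*-identityˡ _) (sum-zero n (λ i → zeroˡ _))) ⟩
    0# + (f n + 0#)
      ≈⟨ trans (+-identityˡ _) (+-identityʳ _) ⟩
    f n ∎

  sum-ones : ∀ n → ∑[ i < n ] (1# * 1#) ≈ ι n
  sum-ones zero    = refl
  sum-ones (suc n) = +-cong (*-identityˡ 1#) (sum-ones n)

  z/[1-z]² : ∀ n → (z ⊛ (1/[1-z] ⊛ 1/[1-z])) n ≈ ι n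
  z/[1-z]² zero    = trans (+-identityʳ _) (zeroˡ _)
  z/[1-z]² (suc n) = trans (z⊛f (1/[1-z] ⊛ 1/[1-z]) n) (sum-ones (suc n))

  -- The coefficients of z/(1-z)² are `ι n`. The one at 0 drops out, and reversing the sum moves the
  -- running index onto `f`.
  z/[1-z]²⊛ : ∀ (f : FPS) n →
    (z ⊛ (1/[1-z] ⊛ 1/[1-z]) ⊛ f) (suc n) ≈ ∑[ i < suc n ] (ι (suc n ∸ toℕ i) * f (toℕ i))
  z/[1-z]²⊛ f n = begin
    ∑[ i < suc (suc n) ] (g (toℕ i) * f (suc n ∸ toℕ i))
      ≈⟨ +-cong (trans (*-congʳ (z/[1-z]² 0)) (zeroˡ _))
                (sum-cong-≋ {suc n} (λ i → *-congʳ {f (n ∸ toℕ i)} (z/[1-z]² (suc (toℕ i))))) ⟩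
    0# + ∑[ i < suc n ] (ι (suc (toℕ i)) * f (n ∸ toℕ i))
      ≈⟨ +-identityˡ _ ⟩
    ∑[ i < suc n ] (ι (suc (toℕ i)) * f (n ∸ toℕ i))
      ≈⟨ sum-reverse n h ⟩
    ∑[ i < suc n ] (ι (suc (n ∸ toℕ i)) * f (n ∸ (n ∸ toℕ i)))
      ≈⟨ sum-cong-≋ {suc n} (λ i → let i≤n = Finₚ.toℕ≤pred[n] i in
           *-cong (ι-cong (≡.sym (ℕₚ.+-∸-assoc 1 i≤n)))
                  (reflexive (≡.cong f (ℕₚ.m∸[m∸n]≡n i≤n)))) ⟩
    ∑[ i < suc n ] (ι (suc n ∸ toℕ i) * f (toℕ i)) ∎
    where
    g = z ⊛ (1/[1-z] ⊛ 1/[1-z])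
    h : ℕ → Carrier
    h i = ι (suc i) * f (n ∸ i)

  z/[1-z]²⊛[1-tS] : ∀ k .{{_ : NonTrivial k}} t a n →
    (z ⊛ (1/[1-z] ⊛ 1/[1-z]) ⊛ (𝟏 ⊖ t · (S k ⟨ a z⟩))) (suc n)
      ≈ ι (suc n) - t * ∑[ j < n ] (ι (n ∸ toℕ j) * s k (suc (toℕ j)) * a ^ suc (toℕ j))
  z/[1-z]²⊛[1-tS] k t a n = begin
    (z ⊛ (1/[1-z] ⊛ 1/[1-z]) ⊛ W) (suc n)
      ≈⟨ z/[1-z]²⊛ W n ⟩
    ι (suc n) * W 0 + ∑[ j < n ] (ι (n ∸ toℕ j) * W (suc (toℕ j)))
      ≈⟨ +-cong constant (sum-cong-≋ {n} (λ j → linear (toℕ j))) ⟩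
    ι (suc n) + ∑[ j < n ] (- t * u (toℕ j))
      ≈⟨ +-congˡ (*-distribˡ-sum {n} (- t) _) ⟨
    ι (suc n) + - t * ∑[ j < n ] u (toℕ j)
      ≈⟨ +-congˡ (-‿distribˡ-* t _) ⟨
    ι (suc n) - t * ∑[ j < n ] u (toℕ j) ∎
    where
    W = 𝟏 ⊖ t · (S k ⟨ a z⟩)
    u : ℕ → Carrier
    u j = ι (n ∸ j) * s k (suc j) * a ^ suc j
    -- `S k` has no constant term, so only `𝟏` contributes.
    constant : ι (suc n) * W 0 ≈ ι (suc n)
    constant = trans (*-congˡ (trans (+-congˡ (-‿cong (trans (*-congˡ (zeroˡ _)) (zeroʳ t)))) (x-0≈x 1#)))
                     (*-identityʳ _)
    linear : ∀ j → ι (n ∸ j) * W (suc j) ≈ - t * u j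
    linear j = begin
      ι (n ∸ j) * (0# - t * (s k (suc j) * a ^ suc j))
        ≈⟨ *-congˡ (trans (+-identityˡ _) (-‿distribˡ-* t _)) ⟩
      ι (n ∸ j) * (- t * (s k (suc j) * a ^ suc j))
        ≈⟨ solve 4 (λ m t s A → m :* (t :* (s :* A)) := t :* (m :* s :* A)) refl _ (- t) _ _ ⟩
      - t * u j ∎

theorem5p1 :
  ∀ {c ℓ₁ ℓ₂} (ℝ : RealNumbers c ℓ₁ ℓ₂) →
  let open RealNumbers ℝ
      open Matchbox ℝ in
  (k : ℕ) → .{{_ : NonTrivial k}} →
  (p : Carrier) → 0# < p → (p<1 : p < 1#) →
  (τ : ℕ → TieBreaking k) →
  let q   = 1# - p
      1/q = q ⁻¹[ x<y⇒0<y-x p<1 ]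
      R   = λ n → 𝔼Y (τ n) n p
  in
  (R 1 ≈ 1#)
  × (∀ n → 2 ≤ n →
       R n ≈ ι n - 1/q * ∑[ j < n ∸ 1 ]
               (let i = suc (toℕ j)
                in ι (n ∸ i) * s k i * (p ^ (k ∸ 1) * q) ^ i))
  × (∑z^ (λ n → R n)
       ≋ z ⊛ (1/[1-z] ⊛ 1/[1-z]) ⊛ (𝟏 ⊖ 1/q · (S k ⟨ p ^ (k ∸ 1) * q z⟩)))
theorem5p1 ℝ (suc (suc κ)) p _ p<1 τ = R₁ , formula , series
  where
  open RealNumbers ℝ
  open Matchbox ℝ
  k : ℕ
  k = suc (suc κ)
  R : ℕ → Carrier
  R = λ n → 𝔼Y (τ n) n p
  q = 1# - p
  1/q = q ⁻¹[ x<y⇒0<y-x p<1 ]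
  R₁ : R 1 ≈ 1#
  -- For one match per box the search list is empty, so Y is constantly its default 1.
  R₁ = trans (𝔼-const ℝ p (k ℕ.* 1) (ι 1)) (+-identityʳ 1#)
  formula : ∀ n → 2 ≤ n → R n ≈ ι n - 1/q * ∑[ j < n ∸ 1 ]
    (ι (n ∸ suc (toℕ j)) * s k (suc (toℕ j)) * (p ^ suc κ * q) ^ suc (toℕ j))
  formula (suc n) _ = 𝔼Y-formula ℝ p κ p<1 (τ (suc n)) n
  series : ∑z^ (λ n → R n) ≋ z ⊛ (1/[1-z] ⊛ 1/[1-z]) ⊛ (𝟏 ⊖ 1/q · (S k ⟨ p ^ suc κ * q z⟩))
  series zero    = sym (trans (+-identityʳ _) (trans (*-congʳ (z/[1-z]² ℝ 0)) (zeroˡ _)))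
  series (suc n) = trans (𝔼Y-formula ℝ p κ p<1 (τ (suc n)) n)
    (sym (z/[1-z]²⊛[1-tS] ℝ k 1/q (p ^ suc κ * q) n))
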